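{- For every $d\geq 2$ there is a collapsible and shellable $d$-dimensional simplicial complex $\Sigma_d$ with $2^d+d+1$ vertices that has exactly one free face.
   Context: A face $\sigma$ of a simplicial complex $C$ is free if it is properly contained in exactly one other face $\tau$ of $C$; removing $\sigma$ and $\tau$ is an elementary collapse. $C$ is collapsible if it can be reduced to a single vertex by a finite sequence of elementary collapses. Shellability is meant in the usual sense for pure simplicial complexes. -}

module Defs where

open import Data.Nat using (ℕ; suc; _≤_; _<_; _∸_)
open import Data.Fin using (Fin; toℕ)
open import Data.Fin.Subset using (Subset; _⊆_; _⊂_; _∩_; ∣_∣; Nonempty; ⁅_⁆)
open import Data.Product using (Σ; Σ-syntax; ∃; ∃-syntax; _×_)
open import Data.List using (List; length; lookup)
open import Data.List.Membership.Propositional using (_∈_)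
open import Data.List.Relation.Unary.Unique.Propositional using (Unique)
open import Relation.Binary.PropositionalEquality using (_≡_; _≢_)
open import Relation.Binary.Construct.Closure.ReflexiveTransitive using (Star)
open import Relation.Nullary using (¬_)
open import Function.Bundles using (_⇔_)

-- A family of faces on the vertex set Fin n, given as a predicate on subsets.
-- Faces are the non-empty vertex sets (the empty face is not counted).
FaceSet : ℕ → Set₁
FaceSet n = Subset n → Set

record Complex (n : ℕ) : Set₁ where
  field
    Face       : FaceSet n
    nonempty   : ∀ σ → Face σ → Nonempty σ
    downClosed : ∀ σ τ → Face τ → σ ⊆ τ → Nonempty σ → Face σ
    vertices   : ∀ (v : Fin n) → Face ⁅ v ⁆
open Complex public

HasDimension : ∀ {n} → FaceSet n → ℕ → Set
HasDimension K d = (∃[ σ ] (K σ × ∣ σ ∣ ≡ suc d)) × (∀ σ → K σ → ∣ σ ∣ ≤ suc d)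

Free : ∀ {n} → FaceSet n → Subset n → Set
Free K σ = K σ × ∃[ τ ] (K τ × σ ⊂ τ × (∀ ρ → K ρ → σ ⊂ ρ → ρ ≡ τ))

ExactlyOneFreeFace : ∀ {n} → FaceSet n → Set
ExactlyOneFreeFace K = ∃[ σ ] (Free K σ × (∀ σ′ → Free K σ′ → σ′ ≡ σ))

ElementaryCollapse : ∀ {n} → FaceSet n → FaceSet n → Set
ElementaryCollapse K L =
  ∃[ σ ] ∃[ τ ] (K σ × K τ × σ ⊂ τ × (∀ ρ → K ρ → σ ⊂ ρ → ρ ≡ τ)
                 × (∀ ρ → L ρ ⇔ (K ρ × ρ ≢ σ × ρ ≢ τ)))

SingleVertex : ∀ {n} → FaceSet n → Set
SingleVertex K = ∃[ v ] (∀ ρ → K ρ ⇔ (ρ ≡ ⁅ v ⁆))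

Collapsible : ∀ {n} → FaceSet n → Set₁
Collapsible K = ∃[ L ] (Star ElementaryCollapse K L × SingleVertex L)

Facet : ∀ {n} → FaceSet n → Subset n → Set
Facet K σ = K σ × (∀ τ → K τ → ¬ (σ ⊂ τ))

PureOfSize : ∀ {n} → ℕ → FaceSet n → Set
PureOfSize m P =
  (∃[ ρ ] (P ρ × ∣ ρ ∣ ≡ m))
  × (∀ ρ → P ρ → ∃[ ρ′ ] (P ρ′ × ρ ⊆ ρ′ × ∣ ρ′ ∣ ≡ m))
  × (∀ ρ → P ρ → ∣ ρ ∣ ≤ m)

Shelling : ∀ {n} → FaceSet n → ℕ → List (Subset n) → Set
Shelling K d Fs =
  Unique Fs
  × (∀ ρ → Facet K ρ ⇔ ρ ∈ Fs)
  × (∀ (j : Fin (length Fs)) → 1 ≤ toℕ j →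
       PureOfSize d (λ ρ → Nonempty ρ × ρ ⊆ lookup Fs j
                          × ∃[ i ] (toℕ i < toℕ j × ρ ⊆ lookup Fs i)))

Shellable : ∀ {n} → FaceSet n → ℕ → Set
Shellable K d =
  (∀ σ → Facet K σ → ∣ σ ∣ ≡ suc d) × ∃[ Fs ] Shelling K d Fs

{-# OPTIONS --safe #-}
-- A shelling is recorded with the restriction R ⊂ F of each facet F, the least
-- face of F not seen before; since R ≠ F, undoing a step of the shelling is a
-- sequence of elementary collapses. Start from a 2-complex on 7 vertices with a
-- single free edge and let 0 be one of its ends. The one-point suspension at 0
-- adds one vertex and one dimension. A face g ∪ {0} keeps its superfaces when
-- both copies of 0 are present; a face with exactly one copy, over g not
-- containing 0, has the superfaces of g, which is not free; a face with neither
-- copy can be extended by either. So the free face stays unique. Stellar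
-- subdivisions of facets then supply the missing vertices without creating or
-- destroying free faces.
module Submission where

open import Defs
open import Data.Bool using (_∧_)
import Data.Bool.Properties as Bool
open import Data.Empty using (⊥; ⊥-elim)
open import Data.Fin using (#_; Fin; zero; suc; toℕ)
open import Data.Fin.Properties using (any?; all?)
open import Data.Fin.Subset using (Subset; Side; inside; outside; _∈_; _∉_; _⊆_; _⊂_; _∪_; _-_; ∣_∣; Nonempty; ⁅_⁆) renaming (⊥ to ∅)
open import Data.Fin.Subset.Properties
open import Data.List using (List; []; _∷_; _++_; map; length; lookup)
open import Data.List.Membership.Propositional using (find) renaming (_∈_ to _∈ₗ_)
open import Data.List.Membership.Propositional.Properties using (∈-lookup)
open import Data.List.Relation.Unary.All as All using (All; []; _∷_)
import Data.List.Relation.Unary.All.Properties as All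
open import Data.List.Relation.Unary.AllPairs using ([]; _∷_)
open import Data.List.Relation.Unary.Any as Any using (Any; here; there)
import Data.List.Relation.Unary.Any.Properties as Any
open import Data.List.Relation.Unary.Unique.Propositional using (Unique)
open import Data.Nat using (ℕ; zero; suc; _≤_; _<_; _+_; _∸_; _^_; z≤n; s≤s)
import Data.Nat as ℕ
open import Data.Nat.Properties hiding (_≟_)
open import Data.Product using (Σ-syntax; ∃-syntax; _×_; _,_; proj₁; proj₂)
open import Data.Sum using ([_,_]′; _⊎_; inj₁; inj₂; map₁; map₂)
open import Data.Vec using ([]; _∷_; here; there; tail)
open import Data.Vec.Properties using (≡-dec; ∷-injectiveʳ)
open import Function using (_∘_; id)
open import Function.Bundles using (_⇔_; mk⇔; Equivalence)
open import Relation.Binary.Construct.Closure.ReflexiveTransitive using (Star; ε; _◅_; _◅◅_)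
open import Relation.Binary.Definitions using (DecidableEquality)
open import Relation.Binary.PropositionalEquality using (setoid; module ≡-Reasoning; _≡_; _≢_; refl; sym; trans; cong; subst)
open import Relation.Nullary using (¬_; Dec; yes; no; contradiction; decidable-stable; map′; toWitness; _×-dec_; _⊎-dec_; _→-dec_; ¬?)
open import Relation.Unary using (Decidable)
open Equivalence using (to; from)

private
  variable
    d n : ℕ
    p q r s ρ σ : Subset n
    x : Fin n
    b : Side

-- The result type is A ⇔ B unfolded: only then does Agda unify it with the goal
-- before checking the arguments, as implicit function types like p ⊆ q require.
iff : {A B : Set} → (A → B) → (B → A) → Equivalence (setoid A) (setoid B)
iff f g = mk⇔ f g

-- Inclusion, deletion and insertion in finite subsets.

_≟_ : DecidableEquality (Subset n)
_≟_ = ≡-dec Bool._≟_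

⊆in : p ⊆ q → b ∷ p ⊆ inside ∷ q
⊆in {b = inside} = in⊆in
⊆in {b = outside} = out⊆

in⊈out : ¬ (inside ∷ p ⊆ outside ∷ q)
in⊈out s with s here
... | ()

⊆⇒≡⊎⊂ : (p q : Subset n) → p ⊆ q → p ≡ q ⊎ p ⊂ q
⊆⇒≡⊎⊂ [] [] s = inj₁ refl
⊆⇒≡⊎⊂ (inside ∷ p) (outside ∷ q) s = ⊥-elim (in⊈out s)
⊆⇒≡⊎⊂ (outside ∷ p) (inside ∷ q) s = inj₂ (out⊂in (drop-∷-⊆ s))
⊆⇒≡⊎⊂ (inside ∷ p) (inside ∷ q) s with ⊆⇒≡⊎⊂ p q (drop-∷-⊆ s)
... | inj₁ refl = inj₁ refl
... | inj₂ p⊂q = inj₂ (s⊂s p⊂q)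
⊆⇒≡⊎⊂ (outside ∷ p) (outside ∷ q) s with ⊆⇒≡⊎⊂ p q (drop-∷-⊆ s)
... | inj₁ refl = inj₁ refl
... | inj₂ p⊂q = inj₂ (s⊂s p⊂q)

⊆∧≥⇒≡ : p ⊆ q → ∣ q ∣ ≤ ∣ p ∣ → p ≡ q
⊆∧≥⇒≡ {p = p} {q = q} s le with ⊆⇒≡⊎⊂ p q s
... | inj₁ eq = eq
... | inj₂ p⊂q = contradiction le (<⇒≱ (p⊂q⇒∣p∣<∣q∣ p⊂q))

⊆∧≢⇒⊂ : p ⊆ q → p ≢ q → p ⊂ q
⊆∧≢⇒⊂ {p = p} {q = q} s p≢q with ⊆⇒≡⊎⊂ p q s
... | inj₁ eq = contradiction eq p≢q
... | inj₂ p⊂q = p⊂q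

⊈⇒∃ : ¬ (p ⊆ q) → ∃[ x ] (x ∈ p × x ∉ q)
⊈⇒∃ {p = p} {q = q} p⊈q with any? (λ x → (x ∈? p) ×-dec ¬? (x ∈? q))
... | yes found = found
... | no none = ⊥-elim
  (p⊈q (λ {x} x∈p → decidable-stable (x ∈? q) (λ x∉q → none (x , x∈p , x∉q))))

⊂⇒⊉ : p ⊂ q → ¬ (q ⊆ p)
⊂⇒⊉ (_ , x , x∈q , x∉p) q⊆p = x∉p (q⊆p x∈q)

p-x⊆p : (p : Subset n) (x : Fin n) → p - x ⊆ p
p-x⊆p p x = p─q⊆p p ⁅ x ⁆

x∉p-x : (p : Subset n) (x : Fin n) → x ∉ p - x
x∉p-x (_ ∷ p) (suc x) (there x∈) = x∉p-x p x x∈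

⊆-delete : r ⊆ p → x ∉ r → r ⊆ p - x
⊆-delete s x∉r y∈r = x∈p∧x≢y⇒x∈p-y (s y∈r) (λ { refl → x∉r y∈r })

∣p-x∣ : x ∈ p → suc ∣ p - x ∣ ≡ ∣ p ∣
∣p-x∣ {p = _ ∷ p} here = cong (suc ∘ ∣_∣) (p─⊥≡p p)
∣p-x∣ {p = inside ∷ p} (there x∈p) = cong suc (∣p-x∣ x∈p)
∣p-x∣ {p = outside ∷ p} (there x∈p) = ∣p-x∣ x∈p

∪⁅⁆⊆ : p ⊆ q → x ∈ q → p ∪ ⁅ x ⁆ ⊆ q
∪⁅⁆⊆ {p = p} {x = x} p⊆q x∈q y∈ with x∈p∪q⁻ p ⁅ x ⁆ y∈
... | inj₁ y∈p = p⊆q y∈p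
... | inj₂ y∈x with refl ← x∈⁅y⁆⇒x≡y x y∈x = x∈q

x∈p∪⁅x⁆ : (p : Subset n) (x : Fin n) → x ∈ p ∪ ⁅ x ⁆
x∈p∪⁅x⁆ p x = q⊆p∪q p ⁅ x ⁆ (x∈⁅x⁆ x)

∉-∪⁅⁆ : {y : Fin n} → y ∉ p → y ≢ x → y ∉ p ∪ ⁅ x ⁆
∉-∪⁅⁆ {p = p} {x = x} y∉p y≢x y∈ with x∈p∪q⁻ p ⁅ x ⁆ y∈
... | inj₁ y∈p = y∉p y∈p
... | inj₂ y∈x = y≢x (x∈⁅y⁆⇒x≡y x y∈x)

-- Collapsing intervals and simplices.

-- The interval [R , F] is emptied along a fixed w ∈ F ∖ R: first the faces
-- containing w, with restriction R ∪ ⁅ w ⁆, then the faces in [R , F - w].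
collapse-interval : ∀ k {K L : FaceSet n} {R F : Subset n} → R ⊂ F → ∣ F ∣ ≤ k + ∣ R ∣ →
  (∀ {ρ} → L ρ → ¬ (R ⊆ ρ)) → (∀ ρ → K ρ ⇔ (L ρ ⊎ (R ⊆ ρ × ρ ⊆ F))) →
  Star ElementaryCollapse K L
collapse-interval zero R⊂F le _ _ = contradiction le (<⇒≱ (p⊂q⇒∣p∣<∣q∣ R⊂F))
collapse-interval (suc k) {K} {L} {R} {F} R⊂F@(R⊆F , w , w∈F , w∉R) le new eqv
  with ⊆⇒≡⊎⊂ R (F - w) (⊆-delete R⊆F w∉R)
-- Here `w` is the only element of `F` outside `R`, so the interval consists of `R` and `F` alone
-- and one elementary collapse removes it.
... | inj₁ R≡F-w = (R , F , KR , KF , R⊂F , only , rest) ◅ ε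
  where
  KR = from (eqv R) (inj₂ ((λ z → z) , R⊆F))
  KF = from (eqv F) (inj₂ (R⊆F , (λ z → z)))

  ends : ∀ {ρ} → R ⊆ ρ → ρ ⊆ F → ρ ≡ R ⊎ ρ ≡ F
  ends {ρ} R⊆ρ ρ⊆F with w ∈? ρ
  ... | no w∉ρ = inj₁ (⊆-antisym (λ y∈ → subst (_ ∈_) (sym R≡F-w) (⊆-delete ρ⊆F w∉ρ y∈)) R⊆ρ)
  ... | yes w∈ρ = inj₂ (⊆-antisym ρ⊆F F⊆ρ)
    where
    F⊆ρ : F ⊆ ρ
    F⊆ρ {y} y∈F with y ∈? ρ
    ... | yes y∈ρ = y∈ρ
    ... | no y∉ρ = R⊆ρ (subst (y ∈_) (sym R≡F-w) (x∈p∧x≢y⇒x∈p-y y∈F (λ { refl → y∉ρ w∈ρ })))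

  only : ∀ ρ → K ρ → R ⊂ ρ → ρ ≡ F
  only ρ Kρ R⊂ρ with to (eqv ρ) Kρ
  ... | inj₁ Lρ = ⊥-elim (new Lρ (proj₁ R⊂ρ))
  ... | inj₂ (R⊆ρ , ρ⊆F) with ends R⊆ρ ρ⊆F
  ... | inj₁ refl = ⊥-elim (⊂⇒⊉ R⊂ρ (λ z → z))
  ... | inj₂ eq = eq

  rest : ∀ ρ → L ρ ⇔ (K ρ × ρ ≢ R × ρ ≢ F)
  rest ρ = iff
    (λ Lρ → from (eqv ρ) (inj₁ Lρ) , (λ { refl → new Lρ (λ z → z) }) , (λ { refl → new Lρ R⊆F }))
    λ { (Kρ , ρ≢R , ρ≢F) → back ρ≢R ρ≢F (to (eqv ρ) Kρ) }
    where
    back : ρ ≢ R → ρ ≢ F → L ρ ⊎ (R ⊆ ρ × ρ ⊆ F) → L ρ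
    back _ _ (inj₁ Lρ) = Lρ
    back ρ≢R ρ≢F (inj₂ (R⊆ρ , ρ⊆F)) with ends R⊆ρ ρ⊆F
    ... | inj₁ eq = contradiction eq ρ≢R
    ... | inj₂ eq = contradiction eq ρ≢F
-- `y` lies outside `R` and differs from `w`, so both halves are nondegenerate: it witnesses
-- `R⁺ ⊂ F` as well as `R ⊂ F - w`.
... | inj₂ R⊂F-w@(_ , y , y∈F-w , y∉R) =
  collapse-interval k upper⊂ upper≤ upper-new upper ◅◅ collapse-interval k R⊂F-w lower≤ new (λ _ → iff id id)
  where
  R⁺ = R ∪ ⁅ w ⁆

  M : FaceSet _
  M ρ = L ρ ⊎ (R ⊆ ρ × ρ ⊆ F - w)

  upper⊂ : R⁺ ⊂ F
  upper⊂ = ∪⁅⁆⊆ R⊆F w∈F , y , p-x⊆p F w y∈F-w , ∉-∪⁅⁆ y∉R (λ { refl → x∉p-x F w y∈F-w })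

  lower≤ : ∣ F - w ∣ ≤ k + ∣ R ∣
  lower≤ = ≤-pred (≤-trans (x∈p⇒∣p-x∣<∣p∣ w∈F) le)

  upper≤ : ∣ F ∣ ≤ k + ∣ R⁺ ∣
  upper≤ = ≤-trans le (≤-trans (≤-reflexive (sym (+-suc k ∣ R ∣)))
    (+-monoʳ-≤ k (p⊂q⇒∣p∣<∣q∣ (p⊆p∪q ⁅ w ⁆ , w , x∈p∪⁅x⁆ R w , w∉R))))

  upper-new : ∀ {ρ} → M ρ → ¬ (R⁺ ⊆ ρ)
  upper-new (inj₁ Lρ) R⁺⊆ρ = new Lρ (R⁺⊆ρ ∘ p⊆p∪q ⁅ w ⁆)
  upper-new (inj₂ (_ , ρ⊆F-w)) R⁺⊆ρ = x∉p-x F w (ρ⊆F-w (R⁺⊆ρ (x∈p∪⁅x⁆ R w)))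

  upper : ∀ ρ → K ρ ⇔ (M ρ ⊎ (R⁺ ⊆ ρ × ρ ⊆ F))
  upper ρ = iff (forth ∘ to (eqv ρ)) (from (eqv ρ) ∘ back)
    where
    forth : L ρ ⊎ (R ⊆ ρ × ρ ⊆ F) → M ρ ⊎ (R⁺ ⊆ ρ × ρ ⊆ F)
    forth (inj₁ Lρ) = inj₁ (inj₁ Lρ)
    forth (inj₂ (R⊆ρ , ρ⊆F)) with w ∈? ρ
    ... | yes w∈ρ = inj₂ (∪⁅⁆⊆ R⊆ρ w∈ρ , ρ⊆F)
    ... | no w∉ρ = inj₁ (inj₂ (R⊆ρ , ⊆-delete ρ⊆F w∉ρ))

    back : M ρ ⊎ (R⁺ ⊆ ρ × ρ ⊆ F) → L ρ ⊎ (R ⊆ ρ × ρ ⊆ F)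
    back (inj₁ (inj₁ Lρ)) = inj₁ Lρ
    back (inj₁ (inj₂ (R⊆ρ , ρ⊆F-w))) = inj₂ (R⊆ρ , p-x⊆p F w ∘ ρ⊆F-w)
    back (inj₂ (R⁺⊆ρ , ρ⊆F)) = inj₂ (R⁺⊆ρ ∘ p⊆p∪q ⁅ w ⁆ , ρ⊆F)

collapsible-cong : {K L : FaceSet n} → (∀ ρ → K ρ ⇔ L ρ) → Collapsible K → Collapsible L
collapsible-cong eqv (_ , ε , v , single) =
  _ , ε , v , λ ρ → iff (to (single ρ) ∘ from (eqv ρ)) (to (eqv ρ) ∘ from (single ρ))
collapsible-cong eqv (M , (σ , τ , Kσ , Kτ , σ⊂τ , only , rest) ◅ steps , single) =
  M , (σ , τ , to (eqv σ) Kσ , to (eqv τ) Kτ , σ⊂τ , (λ ρ → only ρ ∘ from (eqv ρ)) , rest′) ◅ steps , single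
  where
  rest′ = λ ρ → iff
    (λ Mρ → let Kρ , ≢σ , ≢τ = to (rest ρ) Mρ in to (eqv ρ) Kρ , ≢σ , ≢τ)
    (λ { (Lρ , ≢σ , ≢τ) → from (rest ρ) (from (eqv ρ) Lρ , ≢σ , ≢τ) })

-- Returns from families that contain the empty set to the convention of `Complex`.
Nonempties : FaceSet n → FaceSet n
Nonempties K ρ = Nonempty ρ × K ρ

⁅⁆⊆ : x ∈ p → ⁅ x ⁆ ⊆ p
⁅⁆⊆ {x = x} x∈p y∈x with refl ← x∈⁅y⁆⇒x≡y x y∈x = x∈p

-- The faces through `y` form the interval from `⁅ y ⁆` to `F`, a proper one because of `x`;
-- emptying it leaves the simplex on the remaining vertices.
collapse-vertex : {F : Subset n} {x y : Fin n} → x ∈ F → y ∈ F → x ≢ y →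
  Star ElementaryCollapse (Nonempties (_⊆ F)) (Nonempties (_⊆ F - y))
collapse-vertex {F = F} {x} {y} x∈F y∈F x≢y =
  collapse-interval ∣ F ∣ (⁅⁆⊆ y∈F , x , x∈F , x≢y⇒x∉⁅y⁆ x≢y) (m≤m+n ∣ F ∣ _)
    (λ { (_ , ρ⊆F-y) y⊆ρ → x∉p-x F y (ρ⊆F-y (y⊆ρ (x∈⁅x⁆ y))) })
    (λ ρ → iff forth back)
  where
  forth : Nonempties (_⊆ F) ρ → Nonempties (_⊆ F - y) ρ ⊎ (⁅ y ⁆ ⊆ ρ × ρ ⊆ F)
  forth {ρ = ρ} (ne , ρ⊆F) with y ∈? ρ
  ... | yes y∈ρ = inj₂ (⁅⁆⊆ y∈ρ , ρ⊆F)
  ... | no y∉ρ = inj₁ (ne , ⊆-delete ρ⊆F y∉ρ)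

  back : Nonempties (_⊆ F - y) ρ ⊎ (⁅ y ⁆ ⊆ ρ × ρ ⊆ F) → Nonempties (_⊆ F) ρ
  back (inj₁ (ne , ρ⊆F-y)) = ne , p-x⊆p F y ∘ ρ⊆F-y
  back (inj₂ (y⊆ρ , ρ⊆F)) = (y , y⊆ρ (x∈⁅x⁆ y)) , ρ⊆F

-- Vertices other than `x` are removed one at a time; `k` bounds the size of `F` and drops with each
-- of them.
collapse-simplex : ∀ k {F : Subset n} {x : Fin n} → x ∈ F → ∣ F ∣ ≤ k → Collapsible (Nonempties (_⊆ F))
collapse-simplex zero x∈F le = contradiction (x∈p⇒∣p-x∣<∣p∣ x∈F) (≤⇒≯ (≤-trans le z≤n))
collapse-simplex (suc k) {F} {x} x∈F le with ⊆⇒≡⊎⊂ ⁅ x ⁆ F (⁅⁆⊆ x∈F)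
... | inj₁ refl = _ , ε , x , λ ρ → iff (λ { ((y , y∈ρ) , ρ⊆x) → ⊆-antisym ρ⊆x (⁅⁆⊆ (x∈ y∈ρ ρ⊆x)) })
    (λ { refl → (x , x∈⁅x⁆ x) , (λ z → z) })
  where
  x∈ : ∀ {y ρ} → y ∈ ρ → ρ ⊆ ⁅ x ⁆ → x ∈ ρ
  x∈ y∈ρ ρ⊆x with refl ← x∈⁅y⁆⇒x≡y x (ρ⊆x y∈ρ) = y∈ρ
... | inj₂ (_ , y , y∈F , y∉x) =
  let x≢y = λ { refl → y∉x (x∈⁅x⁆ x) }
      M , steps , single = collapse-simplex k (x∈p∧x≢y⇒x∈p-y x∈F x≢y)
                             (≤-pred (≤-trans (x∈p⇒∣p-x∣<∣p∣ y∈F) le))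
  in M , collapse-vertex x∈F y∈F x≢y ◅◅ steps , single

-- Shellings with restriction sets.

-- A shelling step (R , F): the faces of F not seen before are those containing R.
Cell : ℕ → Set
Cell n = Subset n × Subset n

None : FaceSet n
None _ = ⊥

_⊎⊆_ : FaceSet n → Subset n → FaceSet n
(P ⊎⊆ F) ρ = P ρ ⊎ ρ ⊆ F

-- The empty set is tracked along with the faces, so that no case distinction
-- on it is needed in the constructions below.
Attach : FaceSet n → List (Cell n) → FaceSet n → Set
Attach P [] Q = ∀ ρ → P ρ ⇔ Q ρ
Attach P ((R , F) ∷ L) Q = (∀ {ρ} → ρ ⊆ F → P ρ ⇔ (¬ R ⊆ ρ)) × Attach (P ⊎⊆ F) L Q

-- With `R` equal to `F` the whole boundary of `F` would be present beforehand, and adding `F` alone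
-- is not undone by collapses.
Proper : Cell n → Set
Proper (R , F) = R ⊂ F

private
  variable
    P P′ Q Q′ A : FaceSet n
    L L′ : List (Cell n)

attach-cong : (∀ ρ → P′ ρ ⇔ P ρ) → Attach P L Q → Attach P′ L Q
attach-cong {L = []} eqv a ρ = iff (to (a ρ) ∘ to (eqv ρ)) (from (eqv ρ) ∘ from (a ρ))
attach-cong {L = _ ∷ L} eqv (new , a) =
  (λ {ρ} ρ⊆F → iff (to (new ρ⊆F) ∘ to (eqv ρ)) (from (eqv ρ) ∘ from (new ρ⊆F))) ,
  attach-cong {L = L} (λ ρ → iff (map₁ (to (eqv ρ))) (map₁ (from (eqv ρ)))) a

attach-++ : Attach P L Q → Attach Q L′ Q′ → Attach P (L ++ L′) Q′
attach-++ {L = []} {L′ = L′} a b = attach-cong {L = L′} a b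
attach-++ {L = _ ∷ L} (new , a) b = new , attach-++ {L = L} a b

attach-any : Attach P L Q → ∀ ρ → Q ρ ⇔ (P ρ ⊎ Any (λ c → ρ ⊆ proj₂ c) L)
attach-any {L = []} a ρ = iff (inj₁ ∘ from (a ρ)) λ { (inj₁ Pρ) → to (a ρ) Pρ ; (inj₂ ()) }
attach-any {P = P} {L = (R , F) ∷ L} {Q = Q} (_ , a) ρ = iff (forth ∘ to IH) (from IH ∘ back)
  where
  IH = attach-any {L = L} a ρ

  forth : (P ρ ⊎ ρ ⊆ F) ⊎ Any (λ c → ρ ⊆ proj₂ c) L → P ρ ⊎ Any (λ c → ρ ⊆ proj₂ c) ((R , F) ∷ L)
  forth (inj₁ (inj₁ Pρ)) = inj₁ Pρ
  forth (inj₁ (inj₂ ρ⊆F)) = inj₂ (here ρ⊆F)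
  forth (inj₂ later) = inj₂ (there later)

  back : P ρ ⊎ Any (λ c → ρ ⊆ proj₂ c) ((R , F) ∷ L) → (P ρ ⊎ ρ ⊆ F) ⊎ Any (λ c → ρ ⊆ proj₂ c) L
  back (inj₁ Pρ) = inj₁ (inj₁ Pρ)
  back (inj₂ (here ρ⊆F)) = inj₁ (inj₂ ρ⊆F)
  back (inj₂ (there later)) = inj₂ later

-- `Attach` at `ρ = F` would turn `P F` into `¬ R ⊆ F`, against properness. Facets attached later
-- avoid an even larger family.
attach-fresh : Attach P L Q → All Proper L → All (λ c → ¬ P (proj₂ c)) L
attach-fresh {L = []} _ [] = []
attach-fresh {L = _ ∷ L} (new , a) ((R⊆F , _) ∷ proper) =
  (λ PF → to (new (λ z → z)) PF R⊆F) ∷ All.map (λ fresh PF → fresh (inj₁ PF)) (attach-fresh {L = L} a proper)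

attach-unique : Attach P L Q → All Proper L → Unique (map proj₂ L)
attach-unique {L = []} _ [] = []
attach-unique {L = _ ∷ L} (_ , a) (_ ∷ proper) =
  All.map⁺ (All.map (λ { fresh refl → fresh (inj₂ (λ z → z)) }) (attach-fresh {L = L} a proper)) ∷
  attach-unique {L = L} a proper

DownClosed : FaceSet n → Set
DownClosed P = ∀ {σ τ} → σ ⊆ τ → P τ → P σ

-- The shelling is undone from its last facet: each step added exactly the interval from `R` to `F`,
-- which `collapse-interval` removes again.
attach-collapsible : DownClosed P → P ∅ → Attach P L Q → All Proper L →
  Collapsible (Nonempties P) → Collapsible (Nonempties Q)
attach-collapsible {L = []} _ _ a [] =
  collapsible-cong (λ ρ → iff (λ { (ne , Pρ) → ne , to (a ρ) Pρ }) (λ { (ne , Qρ) → ne , from (a ρ) Qρ }))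
attach-collapsible {P = P} {L = (R , F) ∷ L} dc P∅ (new , a) (R⊂F ∷ proper) (M , steps , single) =
  attach-collapsible {L = L} dc′ (inj₁ P∅) a proper
    (M , collapse-interval ∣ F ∣ R⊂F (m≤m+n ∣ F ∣ _) fresh (λ ρ → iff forth back) ◅◅ steps , single)
  where
  dc′ : DownClosed (P ⊎⊆ F)
  dc′ σ⊆τ (inj₁ Pτ) = inj₁ (dc σ⊆τ Pτ)
  dc′ σ⊆τ (inj₂ τ⊆F) = inj₂ (τ⊆F ∘ σ⊆τ)

  fresh : ∀ {ρ} → Nonempties P ρ → ¬ (R ⊆ ρ)
  fresh (_ , Pρ) R⊆ρ = to (new (proj₁ R⊂F)) (dc R⊆ρ Pρ) (λ z → z)

  forth : ∀ {ρ} → Nonempties (P ⊎⊆ F) ρ → Nonempties P ρ ⊎ (R ⊆ ρ × ρ ⊆ F)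
  forth (ne , inj₁ Pρ) = inj₁ (ne , Pρ)
  forth {ρ} (ne , inj₂ ρ⊆F) with R ⊆? ρ
  ... | yes R⊆ρ = inj₂ (R⊆ρ , ρ⊆F)
  ... | no R⊈ρ = inj₁ (ne , from (new ρ⊆F) R⊈ρ)

  back : ∀ {ρ} → Nonempties P ρ ⊎ (R ⊆ ρ × ρ ⊆ F) → Nonempties (P ⊎⊆ F) ρ
  back (inj₁ (ne , Pρ)) = ne , inj₁ Pρ
  -- `∅` is old, so it does not contain `R`; hence `R`, and every face above it, is nonempty.
  back (inj₂ (R⊆ρ , ρ⊆F)) with y , y∈R , _ ← ⊈⇒∃ (to (new (⊥⊆)) P∅) = (y , R⊆ρ y∈R) , inj₂ ρ⊆F

-- Reading off dimension, collapsibility, shellability and the free face.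

Earlier : (Fs : List (Subset n)) → Fin (length Fs) → FaceSet n
Earlier Fs j ρ = ∃[ i ] (toℕ i < toℕ j × ρ ⊆ lookup Fs i)

earlier-∅ : (Fs : List (Subset n)) (j : Fin (length Fs)) → 1 ≤ toℕ j → Earlier Fs j ∅
earlier-∅ (_ ∷ _) j 1≤j = zero , 1≤j , ⊥⊆

-- Rephrases the recursion of `Attach` by positions, as `Shelling` asks: passing a facet moves its
-- faces from `Earlier` into the family `P`.
restriction : Attach P L Q → All Proper L → (j : Fin (length (map proj₂ L))) →
  ∃[ R ] (R ⊂ lookup (map proj₂ L) j × ∀ {ρ} → ρ ⊆ lookup (map proj₂ L) j → (P ρ ⊎ Earlier (map proj₂ L) j ρ) ⇔ (¬ R ⊆ ρ))
restriction {L = (R , F) ∷ L} (new , _) (R⊂F ∷ _) zero =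
  R , R⊂F , λ ρ⊆F → iff (λ { (inj₁ Pρ) → to (new ρ⊆F) Pρ ; (inj₂ (_ , () , _)) }) (inj₁ ∘ from (new ρ⊆F))
restriction {P = P} {L = (R , F) ∷ L} (_ , a) (_ ∷ proper) (suc j) with R′ , R′⊂ , eqv ← restriction {L = L} a proper j =
  R′ , R′⊂ , λ ρ⊆ → iff (to (eqv ρ⊆) ∘ forth) (back ∘ from (eqv ρ⊆))
  where
  forth : P ρ ⊎ Earlier (F ∷ map proj₂ L) (suc j) ρ → (P ⊎⊆ F) ρ ⊎ Earlier (map proj₂ L) j ρ
  forth (inj₁ Pρ) = inj₁ (inj₁ Pρ)
  forth (inj₂ (zero , _ , ρ⊆F)) = inj₁ (inj₂ ρ⊆F)
  forth (inj₂ (suc i , s≤s i<j , ρ⊆)) = inj₂ (i , i<j , ρ⊆)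

  back : (P ⊎⊆ F) ρ ⊎ Earlier (map proj₂ L) j ρ → P ρ ⊎ Earlier (F ∷ map proj₂ L) (suc j) ρ
  back (inj₁ (inj₁ Pρ)) = inj₁ Pρ
  back (inj₁ (inj₂ ρ⊆F)) = inj₂ (zero , s≤s z≤n , ρ⊆F)
  back (inj₂ (i , i<j , ρ⊆)) = inj₂ (suc i , s≤s i<j , ρ⊆)

∣∣>0⇒Nonempty : (p : Subset n) → 0 < ∣ p ∣ → Nonempty p
∣∣>0⇒Nonempty {n} p 0<p with nonempty? p
... | yes ne = ne
... | no empty = contradiction 0<p (≤⇒≯ (≤-reflexive (trans (cong ∣_∣ (Empty-unique empty)) (∣⊥∣≡0 n))))

-- The invariant carried through all constructions. Freeness is taken in a `K` that has the empty
-- set as a member, so `unique` and `inhabited` together also say that `∅` is not free. Indexing by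
-- `σ` lets `suspend` demand that it contains the vertex 0.
record UniquelyFree (d : ℕ) {n : ℕ} (σ : Subset n) : Set₁ where
  field
    cells    : List (Cell n)
    K        : FaceSet n
    attach   : Attach None cells K
    proper   : All Proper cells
    pure     : All (λ c → ∣ proj₂ c ∣ ≡ suc d) cells
    covers   : ∀ v → K ⁅ v ⁆
    inhabited : Nonempty σ
    free     : Free K σ
    unique   : ∀ ρ → Free K ρ → ρ ≡ σ

  facets : List (Subset n)
  facets = map proj₂ cells

  facet-pure : ∀ {F} → F ∈ₗ facets → ∣ F ∣ ≡ suc d
  facet-pure = All.lookup (All.map⁺ pure)

  below-facet : ∀ {ρ} → K ρ → ∃[ F ] (F ∈ₗ facets × ρ ⊆ F)
  below-facet {ρ} Kρ with to (attach-any {L = cells} attach _) Kρ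
  ... | inj₂ found with F , F∈ , ρ⊆F ← find (Any.map⁺ {P = ρ ⊆_} found) = F , F∈ , λ {_} → ρ⊆F

  facet-below : ∀ {F ρ} → F ∈ₗ facets → ρ ⊆ F → K ρ
  facet-below {F} {ρ} F∈ ρ⊆F = from (attach-any {L = cells} attach _)
    (inj₂ (Any.map⁻ {P = ρ ⊆_} (Any.map (λ { refl {_} → ρ⊆F }) F∈)))

  closed : DownClosed K
  closed σ⊆τ Kτ with F , F∈ , τ⊆F ← below-facet Kτ = facet-below F∈ (τ⊆F ∘ σ⊆τ)

  size≤ : ∀ {ρ} → K ρ → ∣ ρ ∣ ≤ suc d
  size≤ Kρ with F , F∈ , ρ⊆F ← below-facet Kρ = ≤-trans (p⊆q⇒∣p∣≤∣q∣ ρ⊆F) (≤-reflexive (facet-pure F∈))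

  facet-maximal : ∀ {F τ} → F ∈ₗ facets → K τ → ¬ (F ⊂ τ)
  facet-maximal F∈ Kτ F⊂τ =
    <⇒≱ (p⊂q⇒∣p∣<∣q∣ F⊂τ) (≤-trans (size≤ Kτ) (≤-reflexive (sym (facet-pure F∈))))

  facet-nonempty : ∀ {F} → F ∈ₗ facets → Nonempty F
  facet-nonempty {F} F∈ = ∣∣>0⇒Nonempty F (subst (0 <_) (sym (facet-pure F∈)) (s≤s z≤n))

  complex : Complex n
  complex .Face = Nonempties K
  complex .nonempty _ = proj₁
  complex .downClosed _ _ (_ , Kτ) σ⊆τ ne = ne , closed σ⊆τ Kτ
  complex .vertices v = (v , x∈⁅x⁆ v) , covers v

  hasDimension : HasDimension (Face complex) d
  hasDimension with F , F∈ , _ ← below-facet (proj₁ free) =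
    (F , (facet-nonempty F∈ , facet-below F∈ (λ z → z)) , facet-pure F∈) , λ _ → size≤ ∘ proj₂

  collapsible : Collapsible (Face complex)
  collapsible = start cells attach proper pure (proj₁ (proj₂ (below-facet (proj₁ free))))
    where
    start : ∀ L → Attach None L K → All Proper L → All (λ c → ∣ proj₂ c ∣ ≡ suc d) L →
      ∀ {F} → F ∈ₗ map proj₂ L → Collapsible (Nonempties K)
    -- The first facet alone is a full simplex, hence collapsible; the remaining steps attach to it.
    start ((R , F) ∷ L) (_ , a) (_ ∷ proper) (∣F∣ ∷ _) _
      with x , x∈F ← ∣∣>0⇒Nonempty F (subst (0 <_) (sym ∣F∣) (s≤s z≤n)) =
      attach-collapsible {P = None ⊎⊆ F} {L = L} (λ { σ⊆τ (inj₂ τ⊆F) → inj₂ (τ⊆F ∘ σ⊆τ) }) (inj₂ ⊥⊆) a proper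
        (collapsible-cong {K = Nonempties (_⊆ F)} (λ ρ → iff forth back) (collapse-simplex ∣ F ∣ x∈F ≤-refl))
      where
      forth : ∀ {ρ} → Nonempties (_⊆ F) ρ → Nonempties (None ⊎⊆ F) ρ
      forth (ne , ρ⊆F) = ne , inj₂ ρ⊆F

      back : ∀ {ρ} → Nonempties (None ⊎⊆ F) ρ → Nonempties (_⊆ F) ρ
      back (ne , inj₂ ρ⊆F) = ne , ρ⊆F

  facet⇔ : ∀ ρ → Facet (Face complex) ρ ⇔ ρ ∈ₗ facets
  facet⇔ ρ = iff forth (λ ρ∈ → (facet-nonempty ρ∈ , facet-below ρ∈ (λ z → z)) , λ _ → facet-maximal ρ∈ ∘ proj₂)
    where
    forth : Facet (Face complex) ρ → ρ ∈ₗ facets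
    forth ((_ , Kρ) , maximal) with F , F∈ , ρ⊆F ← below-facet Kρ with ⊆⇒≡⊎⊂ ρ F ρ⊆F
    ... | inj₁ refl = F∈
    ... | inj₂ ρ⊂F = contradiction ρ⊂F (maximal F (facet-nonempty F∈ , facet-below F∈ (λ z → z)))

  shellable : 1 ≤ d → Shellable (Face complex) d
  shellable 1≤d = (λ σ → facet-pure ∘ to (facet⇔ σ)) ,
    facets , attach-unique {L = cells} attach proper , facet⇔ , old-pure
    where
    old-pure : ∀ j → 1 ≤ toℕ j → PureOfSize d (λ ρ → Nonempty ρ × ρ ⊆ lookup facets j × Earlier facets j ρ)
    old-pure j 1≤j with R , (R⊆F , _) , old⇔ ← restriction {L = cells} attach proper j =
      -- An old face of size `d` exists because `∅` is old: it lies in the facet at position 0.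
      (let ρ , old , _ , size = ridge ⊥⊆ (to (old⇔ {∅} ⊥⊆) (inj₂ (earlier-∅ facets j 1≤j))) in ρ , old , size) ,
      (λ { ρ (_ , ρ⊆F , old) → ridge ρ⊆F (to (old⇔ {ρ} ρ⊆F) (inj₂ old)) }) ,
      (λ { ρ (_ , ρ⊆F , old) → let _ , _ , ρ⊆ , size = ridge ρ⊆F (to (old⇔ {ρ} ρ⊆F) (inj₂ old)) in
                               ≤-trans (p⊆q⇒∣p∣≤∣q∣ ρ⊆) (≤-reflexive size) })
      where
      F = lookup facets j

      -- An old `ρ` misses some `x ∈ R`, so it lies in `F - x`, which misses `x` as well and is
      -- therefore old. The bound `1 ≤ d` keeps `F - x` nonempty.
      ridge : ∀ {ρ} → ρ ⊆ F → ¬ (R ⊆ ρ) →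
        ∃[ ρ′ ] ((Nonempty ρ′ × ρ′ ⊆ F × Earlier facets j ρ′) × ρ ⊆ ρ′ × ∣ ρ′ ∣ ≡ d)
      ridge ρ⊆F R⊈ρ with x , x∈R , x∉ρ ← ⊈⇒∃ R⊈ρ =
        F - x , (∣∣>0⇒Nonempty (F - x) (subst (1 ≤_) (sym size) 1≤d) , p-x⊆p F x , old) , ⊆-delete ρ⊆F x∉ρ , size
        where
        size : ∣ F - x ∣ ≡ d
        size = suc-injective (trans (∣p-x∣ (R⊆F x∈R)) (facet-pure (∈-lookup j)))

        old : Earlier facets j (F - x)
        old with from (old⇔ (p-x⊆p F x)) (λ R⊆ → x∉p-x F x (R⊆ x∈R))
        ... | inj₂ earlier = earlier

  -- A proper superset is never empty, so dropping the empty set from `K` changes the proper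
  -- superfaces of no face.
  exactlyOneFreeFace : ExactlyOneFreeFace (Face complex)
  exactlyOneFreeFace with Kσ , τ , Kτ , σ⊂τ@(_ , x , x∈τ , _) , only ← free =
    σ , ((inhabited , Kσ) , τ , ((x , x∈τ) , Kτ) , σ⊂τ , λ ρ → only ρ ∘ proj₂) ,
    λ { ρ ((_ , Kρ) , υ , (_ , Kυ) , ρ⊂υ , only′) →
        unique ρ (Kρ , υ , Kυ , ρ⊂υ , λ { π Kπ ρ⊂π@(_ , y , y∈π , _) → only′ π ((y , y∈π) , Kπ) ρ⊂π }) }

-- One-point suspension.

-- The one-point suspension of K at the vertex 0 is K ∘ fold: the vertex 0 is
-- doubled, and any face may use one of the two copies without using 0.
fold : Subset (suc (suc n)) → Subset (suc n)
fold (a ∷ b ∷ p) = (a ∧ b) ∷ p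

double : Subset (suc n) → Subset (suc (suc n))
double (b ∷ p) = b ∷ b ∷ p

-- An adjunction: `double r` is the least set whose fold contains `r`, which makes `double R` the
-- restriction of a lifted cell.
double-⊆ : ∀ (r : Subset (suc n)) ρ → double r ⊆ ρ ⇔ r ⊆ fold ρ
double-⊆ (outside ∷ r) (a ∷ b ∷ p) = iff (λ s → out⊆ (drop-∷-⊆ (drop-∷-⊆ s))) (λ s → out⊆ (out⊆ (drop-∷-⊆ s)))
double-⊆ (inside ∷ r) (inside ∷ inside ∷ p) = iff drop-∷-⊆ in⊆in
double-⊆ (inside ∷ r) (inside ∷ outside ∷ p) = iff drop-∷-⊆ (⊥-elim ∘ in⊈out)
double-⊆ (inside ∷ r) (outside ∷ b ∷ p) = iff (λ s → ⊥-elim (in⊈out s)) (λ s → ⊥-elim (in⊈out s))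

fold-⊆-inside : ∀ (ρ : Subset (suc (suc n))) → ρ ⊆ double (inside ∷ q) ⇔ fold ρ ⊆ inside ∷ q
fold-⊆-inside (a ∷ b ∷ p) = iff (λ s → ⊆in (drop-∷-⊆ (drop-∷-⊆ s))) (λ s → ⊆in (⊆in (drop-∷-⊆ s)))

-- A set folding into a facet without 0 has at most one copy of 0, so such a facet has two lifts,
-- one for each copy.
fold-⊆-outside : ∀ (ρ : Subset (suc (suc n))) →
  (ρ ⊆ outside ∷ inside ∷ q ⊎ ρ ⊆ inside ∷ outside ∷ q) ⇔ fold ρ ⊆ outside ∷ q
fold-⊆-outside {q = q} (a ∷ b ∷ p) = iff forth back
  where
  forth : ∀ {a b} → a ∷ b ∷ p ⊆ outside ∷ inside ∷ q ⊎ a ∷ b ∷ p ⊆ inside ∷ outside ∷ q → (a ∧ b) ∷ p ⊆ outside ∷ q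
  forth {inside} (inj₁ s) = ⊥-elim (in⊈out s)
  forth {outside} (inj₁ s) = out⊆ (drop-∷-⊆ (drop-∷-⊆ s))
  forth {inside} (inj₂ s) = drop-∷-⊆ s
  forth {outside} {inside} (inj₂ s) = ⊥-elim (in⊈out (drop-∷-⊆ s))
  forth {outside} {outside} (inj₂ s) = drop-∷-⊆ s

  back : ∀ {a b} → (a ∧ b) ∷ p ⊆ outside ∷ q → a ∷ b ∷ p ⊆ outside ∷ inside ∷ q ⊎ a ∷ b ∷ p ⊆ inside ∷ outside ∷ q
  back {outside} s = inj₁ (out⊆ (⊆in (drop-∷-⊆ s)))
  back {inside} {outside} s = inj₂ (in⊆in s)
  back {inside} {inside} s = ⊥-elim (in⊈out s)

-- A facet through 0 has one lift, any other has two. These two share the faces with neither copy,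
-- so the second lift gains its own copy in the restriction. For a proper cell the wildcard is
-- `outside`.
suspendCells : List (Cell (suc n)) → List (Cell (suc (suc n)))
suspendCells [] = []
suspendCells ((R , inside ∷ G) ∷ L) = (double R , double (inside ∷ G)) ∷ suspendCells L
suspendCells ((_ ∷ R , outside ∷ G) ∷ L) =
  (outside ∷ outside ∷ R , outside ∷ inside ∷ G) ∷ (inside ∷ outside ∷ R , inside ∷ outside ∷ G) ∷ suspendCells L

attach-suspend : All Proper L → Attach P L Q → Attach (P ∘ fold) (suspendCells L) (Q ∘ fold)
attach-suspend {L = []} [] a ρ = a (fold ρ)
attach-suspend {L = (R , inside ∷ G) ∷ L} {P = P} (_ ∷ proper) (new , a) =
  (λ {ρ} ρ⊆ → iff
    (λ Pρ s → to (new (to (fold-⊆-inside ρ) ρ⊆)) Pρ (to (double-⊆ R ρ) s))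
    (λ ¬s → from (new (to (fold-⊆-inside ρ) ρ⊆)) (λ s → ¬s (from (double-⊆ R ρ) s)))) ,
  attach-cong {L = suspendCells L}
    (λ ρ → iff (map₂ (to (fold-⊆-inside ρ))) (map₂ (from (fold-⊆-inside ρ))))
    (attach-suspend proper a)
attach-suspend {L = (inside ∷ R , outside ∷ G) ∷ L} ((R⊆F , _) ∷ _) _ = ⊥-elim (in⊈out R⊆F)
attach-suspend {L = (outside ∷ R , outside ∷ G) ∷ L} {P = P} (_ ∷ proper) (new , a) =
  (λ {ρ} ρ⊆ → iff
    (λ Pρ s → to (new (to (fold-⊆-outside ρ) (inj₁ ρ⊆))) Pρ (to (double-⊆ (outside ∷ R) ρ) s))
    (λ ¬s → from (new (to (fold-⊆-outside ρ) (inj₁ ρ⊆))) (λ s → ¬s (from (double-⊆ (outside ∷ R) ρ) s)))) ,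
  (λ {ρ} → second ρ) ,
  attach-cong {L = suspendCells L} (λ ρ → iff (forth ρ) (back ρ)) (attach-suspend proper a)
  where
  second : ∀ ρ → ρ ⊆ inside ∷ outside ∷ G →
    ((P ∘ fold) ⊎⊆ (outside ∷ inside ∷ G)) ρ ⇔ (¬ (inside ∷ outside ∷ R ⊆ ρ))
  second (_ ∷ inside ∷ g) ρ⊆ = ⊥-elim (in⊈out (drop-∷-⊆ ρ⊆))
  second (outside ∷ outside ∷ g) ρ⊆ =
    iff (λ _ s → in⊈out s) (λ _ → inj₂ (out⊆ (out⊆ (drop-∷-⊆ (drop-∷-⊆ ρ⊆)))))
  second (inside ∷ outside ∷ g) ρ⊆ = iff
    (λ { (inj₁ Pρ) s → to (new (drop-∷-⊆ ρ⊆)) Pρ (drop-∷-⊆ s)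
       ; (inj₂ s) _ → in⊈out s })
    (λ ¬s → inj₁ (from (new (drop-∷-⊆ ρ⊆)) (λ s → ¬s (in⊆in s))))

  forth : ∀ ρ → (((P ∘ fold) ⊎⊆ (outside ∷ inside ∷ G)) ⊎⊆ (inside ∷ outside ∷ G)) ρ →
    (P ⊎⊆ (outside ∷ G)) (fold ρ)
  forth ρ (inj₁ (inj₁ Pρ)) = inj₁ Pρ
  forth ρ (inj₁ (inj₂ ρ⊆)) = inj₂ (to (fold-⊆-outside ρ) (inj₁ ρ⊆))
  forth ρ (inj₂ ρ⊆) = inj₂ (to (fold-⊆-outside ρ) (inj₂ ρ⊆))

  back : ∀ ρ → (P ⊎⊆ (outside ∷ G)) (fold ρ) →
    (((P ∘ fold) ⊎⊆ (outside ∷ inside ∷ G)) ⊎⊆ (inside ∷ outside ∷ G)) ρ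
  back ρ (inj₁ Pρ) = inj₁ (inj₁ Pρ)
  back ρ (inj₂ s) with from (fold-⊆-outside ρ) s
  ... | inj₁ ρ⊆ = inj₁ (inj₂ ρ⊆)
  ... | inj₂ ρ⊆ = inj₂ ρ⊆

suspend-proper : All Proper L → All Proper (suspendCells L)
suspend-proper {L = []} [] = []
suspend-proper {L = (inside ∷ R , inside ∷ G) ∷ L} (R⊂F ∷ proper) = in⊂in R⊂F ∷ suspend-proper proper
suspend-proper {L = (outside ∷ R , inside ∷ G) ∷ L} ((R⊆F , _) ∷ proper) =
  out⊂in (⊆in (drop-∷-⊆ R⊆F)) ∷ suspend-proper proper
suspend-proper {L = (inside ∷ R , outside ∷ G) ∷ L} ((R⊆F , _) ∷ proper) = ⊥-elim (in⊈out R⊆F)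
suspend-proper {L = (outside ∷ R , outside ∷ G) ∷ L} (R⊂F@(R⊆F , _) ∷ proper) =
  out⊂ (out⊂in (drop-∷-⊆ R⊆F)) ∷ in⊂in R⊂F ∷ suspend-proper proper

suspend-pure : All (λ c → ∣ proj₂ c ∣ ≡ suc d) L → All (λ c → ∣ proj₂ c ∣ ≡ suc (suc d)) (suspendCells L)
suspend-pure {L = []} [] = []
suspend-pure {L = (R , inside ∷ G) ∷ L} (size ∷ pure) = cong suc size ∷ suspend-pure pure
suspend-pure {L = (_ ∷ R , outside ∷ G) ∷ L} (size ∷ pure) = cong suc size ∷ cong suc size ∷ suspend-pure pure

insert-⊂ : ∀ {c} → outside ∷ p ⊂ c ∷ q → outside ∷ inside ∷ p ⊂ c ∷ inside ∷ q
insert-⊂ {c = inside} (s , _) = out⊂in (in⊆in (drop-∷-⊆ s))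
insert-⊂ {c = outside} s = out⊂ (in⊂in (drop-∷-⊂ s))

remove-⊂ : ∀ {c} → outside ∷ inside ∷ p ⊂ c ∷ inside ∷ q → outside ∷ p ⊂ c ∷ q
remove-⊂ {c = inside} (s , _) = out⊂in (drop-∷-⊆ (drop-∷-⊆ s))
remove-⊂ {c = outside} s = out⊂ (drop-∷-⊂ (drop-∷-⊂ s))

-- Every superset also has both copies, and there `fold` merely merges them, so superfaces
-- correspond one to one.
fold-free : Free P (inside ∷ s) → Free (P ∘ fold) (inside ∷ inside ∷ s)
fold-free (_ , outside ∷ t , _ , (s⊆t , _) , _) = ⊥-elim (in⊈out s⊆t)
fold-free {P = P} {s = s} (Ps , inside ∷ t , Pt , s⊂t , only) = Ps , inside ∷ inside ∷ t , Pt , in⊂in s⊂t , only′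
  where
  only′ : ∀ ρ → P (fold ρ) → inside ∷ inside ∷ s ⊂ ρ → ρ ≡ inside ∷ inside ∷ t
  only′ (outside ∷ _) _ (s⊆ρ , _) = ⊥-elim (in⊈out s⊆ρ)
  only′ (inside ∷ outside ∷ _) _ (s⊆ρ , _) = ⊥-elim (in⊈out (drop-∷-⊆ s⊆ρ))
  only′ (inside ∷ inside ∷ g) Pg s⊂g = cong (inside ∷_) (only (inside ∷ g) Pg (drop-∷-⊂ s⊂g))

fold-unique : (∀ ρ → Free P ρ → ρ ≡ inside ∷ s) → ∀ ρ → Free (P ∘ fold) ρ → ρ ≡ inside ∷ inside ∷ s
fold-unique unique (outside ∷ outside ∷ g) (Pg , τ , _ , _ , only)
  with () ← trans (only (inside ∷ outside ∷ g) Pg (out⊂in (λ z → z)))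
                  (sym (only (outside ∷ inside ∷ g) Pg (out⊂ (out⊂in (λ z → z)))))
fold-unique unique (outside ∷ inside ∷ g) (Pg , _ ∷ outside ∷ h , _ , (g⊆h , _) , _) = ⊥-elim (in⊈out (drop-∷-⊆ g⊆h))
-- Superfaces `c ∷ inside ∷ h` correspond to superfaces `c ∷ h` of `outside ∷ g`, so the latter
-- would be free without containing 0.
fold-unique {P = P} unique (outside ∷ inside ∷ g) (Pg , c ∷ inside ∷ h , Ph , g⊂h , only) =
  contradiction (unique (outside ∷ g)
    (Pg , c ∷ h , subst (λ c′ → P (c′ ∷ h)) (Bool.∧-identityʳ c) Ph , remove-⊂ g⊂h , only′)) (λ ())
  where
  only′ : ∀ π → P π → outside ∷ g ⊂ π → π ≡ c ∷ h
  only′ (c′ ∷ h′) Pπ g⊂π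
    with refl ← only (c′ ∷ inside ∷ h′) (subst (λ c″ → P (c″ ∷ h′)) (sym (Bool.∧-identityʳ c′)) Pπ) (insert-⊂ g⊂π) = refl
fold-unique unique (inside ∷ _ ∷ g) (_ , outside ∷ _ , _ , (g⊆h , _) , _) = ⊥-elim (in⊈out g⊆h)
-- On sets with the first copy `fold` just forgets it. Both values of `b` are treated at once, and
-- uniqueness forces `b` to be `inside`.
fold-unique {P = P} unique (inside ∷ b ∷ g) (Pg , inside ∷ τ , Pτ , g⊂τ , only) =
  cong (inside ∷_) (unique (b ∷ g) (Pg , τ , unfold τ Pτ , drop-∷-⊂ g⊂τ , only′))
  where
  unfold : ∀ π → P (fold (inside ∷ π)) → P π
  unfold (_ ∷ _) Pπ = Pπ

  only′ : ∀ π → P π → b ∷ g ⊂ π → π ≡ τ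
  only′ (c ∷ h) Pπ g⊂π = ∷-injectiveʳ (only (inside ∷ c ∷ h) Pπ (s⊂s g⊂π))

-- The new free face contains the new vertex 0 again, so the construction can be iterated.
suspend : UniquelyFree d (inside ∷ s) → UniquelyFree (suc d) (inside ∷ inside ∷ s)
suspend {d = d} {s = s} U = record
  { cells = suspendCells cells
  ; K = K ∘ fold
  ; attach = attach-suspend proper attach
  ; proper = suspend-proper proper
  ; pure = suspend-pure pure
  -- Either copy of 0 alone folds to `∅`.
  ; covers = λ { zero → K∅ ; (suc zero) → K∅ ; (suc (suc v)) → covers (suc v) }
  ; inhabited = zero , here
  ; free = fold-free free
  ; unique = fold-unique unique
  }
  where
  open UniquelyFree U
  K∅ = closed ⊥⊆ (covers zero)

-- Stellar subdivision of a facet.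

-- `A` is the link of the new vertex 0 and `B` its deletion.
split : FaceSet n → FaceSet n → FaceSet (suc n)
split A B (inside ∷ p) = A p
split A B (outside ∷ p) = B p

stretch : Side → Cell n → Cell (suc n)
stretch b (R , F) = b ∷ R , b ∷ F

cone : Cell n → Cell (suc n)
cone (R , F) = outside ∷ R , inside ∷ F

attach-end : (∀ ρ → Q ρ ⇔ Q′ ρ) → Attach P L Q → Attach P L Q′
attach-end {L = []} eqv a ρ = iff (to (eqv ρ) ∘ to (a ρ)) (from (a ρ) ∘ from (eqv ρ))
attach-end {L = _ ∷ L} eqv (new , a) = new , attach-end {L = L} eqv a

attach-outside : Attach P L Q → Attach (split A P) (map (stretch outside) L) (split A Q)
attach-outside {L = []} a (inside ∷ p) = iff id id
attach-outside {L = []} a (outside ∷ p) = a p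
attach-outside {P = P} {L = (R , F) ∷ L} {A = A} (new , a) =
  (λ {ρ} → new′ ρ) , attach-cong {L = map (stretch outside) L} eqv (attach-outside {L = L} a)
  where
  new′ : ∀ ρ → ρ ⊆ outside ∷ F → split A P ρ ⇔ (¬ (outside ∷ R ⊆ ρ))
  new′ (inside ∷ p) s = ⊥-elim (in⊈out s)
  new′ (outside ∷ p) s = iff (λ Pp t → to (new (drop-∷-⊆ s)) Pp (drop-∷-⊆ t))
    (λ ¬t → from (new (drop-∷-⊆ s)) (λ t → ¬t (out⊆ t)))

  eqv : ∀ ρ → (split A P ⊎⊆ (outside ∷ F)) ρ ⇔ split A (P ⊎⊆ F) ρ
  eqv (inside ∷ p) = iff (λ { (inj₁ Ap) → Ap ; (inj₂ s) → ⊥-elim (in⊈out s) }) inj₁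
  eqv (outside ∷ p) = iff (map₂ (λ s → drop-∷-⊆ s)) (map₂ (λ s → out⊆ s))

-- Sets below `inside ∷ F` without the vertex 0 are old already, as `F ⊆ G`; hence 0 joins the
-- restriction.
attach-inside : ∀ {G : Subset n} → All (λ c → proj₂ c ⊆ G) L → Attach P L Q →
  Attach (split P (_⊆ G)) (map (stretch inside) L) (split Q (_⊆ G))
attach-inside {L = []} [] a (inside ∷ p) = a p
attach-inside {L = []} [] a (outside ∷ p) = iff id id
attach-inside {L = (R , F) ∷ L} {P = P} {G = G} (F⊆G ∷ below) (new , a) =
  (λ {ρ} → new′ ρ) , attach-cong {L = map (stretch inside) L} eqv (attach-inside {L = L} below a)
  where
  new′ : ∀ ρ → ρ ⊆ inside ∷ F → split P (_⊆ G) ρ ⇔ (¬ (inside ∷ R ⊆ ρ))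
  new′ (outside ∷ p) s = iff (λ _ t → in⊈out t) (λ _ → F⊆G ∘ drop-∷-⊆ s)
  new′ (inside ∷ p) s = iff (λ Pp t → to (new (drop-∷-⊆ s)) Pp (drop-∷-⊆ t))
    (λ ¬t → from (new (drop-∷-⊆ s)) (λ t → ¬t (in⊆in t)))

  eqv : ∀ ρ → (split P (_⊆ G) ⊎⊆ (inside ∷ F)) ρ ⇔ split (P ⊎⊆ F) (_⊆ G) ρ
  eqv (outside ∷ p) = iff (λ { (inj₁ s) → s ; (inj₂ s) → F⊆G ∘ drop-∷-⊆ s }) (λ s → inj₁ s)
  eqv (inside ∷ p) = iff (map₂ (λ s → drop-∷-⊆ s)) (map₂ (λ s → in⊆in s))

-- Whether a face of the cone is old depends only on its base, so the apex stays out of the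
-- restrictions.
attach-cone : Attach P L Q → Attach (P ∘ tail) (map cone L) (Q ∘ tail)
attach-cone {L = []} a (_ ∷ p) = a p
attach-cone {P = P} {L = (R , F) ∷ L} (new , a) =
  (λ {ρ} → new′ ρ) , attach-cong {L = map cone L} eqv (attach-cone {L = L} a)
  where
  new′ : ∀ ρ → ρ ⊆ inside ∷ F → P (tail ρ) ⇔ (¬ (outside ∷ R ⊆ ρ))
  new′ (_ ∷ p) s = iff (λ Pp t → to (new (drop-∷-⊆ s)) Pp (drop-∷-⊆ t))
    (λ ¬t → from (new (drop-∷-⊆ s)) (λ t → ¬t (out⊆ t)))

  eqv : ∀ ρ → ((P ∘ tail) ⊎⊆ (inside ∷ F)) ρ ⇔ (P ⊎⊆ F) (tail ρ)
  eqv (_ ∷ p) = iff (map₂ (λ s → drop-∷-⊆ s)) (map₂ (λ s → ⊆in s))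

-- The boundary of a simplex, shelled by omitting the vertices of `F` in increasing order; each
-- restriction consists of the vertices before the omitted one.
∂ : Subset n → List (Cell n)
∂ [] = []
∂ (outside ∷ F) = map (stretch outside) (∂ F)
∂ (inside ∷ F) = (∅ , outside ∷ F) ∷ map (stretch inside) (∂ F)

-- The inclusion `R ⊆ G` is not strict, since the last ridge closes the sphere and has `R = G`.
-- Properness returns with the cone, whose apex lies outside `R`.
Ridge : Subset n → Cell n → Set
Ridge F (R , G) = R ⊆ G × G ⊆ F × suc ∣ G ∣ ≡ ∣ F ∣

stretch-ridge : ∀ b {F : Subset n} {c : Cell n} → Ridge F c → Ridge (b ∷ F) (stretch b c)
stretch-ridge inside (R⊆G , G⊆F , size) = in⊆in R⊆G , in⊆in G⊆F , cong suc size
stretch-ridge outside (R⊆G , G⊆F , size) = out⊆ R⊆G , out⊆ G⊆F , size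

∂-ridges : (F : Subset n) → All (Ridge F) (∂ F)
∂-ridges [] = []
∂-ridges (outside ∷ F) = All.map⁺ (All.map (λ {c} → stretch-ridge outside {F} {c}) (∂-ridges F))
∂-ridges (inside ∷ F) =
  (⊥⊆ , out⊆ (λ z → z) , refl) ∷ All.map⁺ (All.map (λ {c} → stretch-ridge inside {F} {c}) (∂-ridges F))

attach-∂ : (F : Subset n) → Attach None (∂ F) (_⊂ F)
attach-∂ [] [] = iff (λ ()) (λ { (_ , () , _) })
attach-∂ (outside ∷ F) = attach-cong {L = ∂ (outside ∷ F)} start
  (attach-end {L = ∂ (outside ∷ F)} end (attach-outside {L = ∂ F} {A = None} (attach-∂ F)))
  where
  start : ∀ ρ → None ρ ⇔ split None None ρ
  start (inside ∷ _) = iff id id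
  start (outside ∷ _) = iff id id

  end : ∀ ρ → split None (_⊂ F) ρ ⇔ ρ ⊂ outside ∷ F
  end (inside ∷ _) = iff (λ ()) (λ { (s , _) → in⊈out s })
  end (outside ∷ _) = iff out⊂ drop-∷-⊂
attach-∂ (inside ∷ F) = (λ _ → iff (λ ()) (λ ⊈ → ⊥-elim (⊈ ⊥⊆))) ,
  attach-cong {L = map (stretch inside) (∂ F)} start
    (attach-end {L = map (stretch inside) (∂ F)} end
      (attach-inside (All.map (λ c → proj₁ (proj₂ c)) (∂-ridges F)) (attach-∂ F)))
  where
  start : ∀ ρ → (None ⊎⊆ (outside ∷ F)) ρ ⇔ split None (_⊆ F) ρ
  start (inside ∷ _) = iff (λ { (inj₂ s) → in⊈out s }) (λ ())
  start (outside ∷ _) = iff (λ { (inj₂ s) → drop-∷-⊆ s }) (λ s → inj₂ (out⊆ s))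

  end : ∀ ρ → split (_⊂ F) (_⊆ F) ρ ⇔ ρ ⊂ inside ∷ F
  end (inside ∷ _) = iff in⊂in drop-∷-⊂
  end (outside ∷ _) = iff (λ s → out⊂in s) (λ { (s , _) → drop-∷-⊆ s })

_∖_ : FaceSet n → Subset n → FaceSet n
(P ∖ F) ρ = P ρ × ρ ≢ F

-- No attached facet contains `F₀`, so its removal is invisible inside each attached simplex.
attach-∖ : ∀ {F₀ : Subset n} → All (λ c → ¬ (F₀ ⊆ proj₂ c)) L → Attach P L Q → Attach (P ∖ F₀) L (Q ∖ F₀)
attach-∖ {L = []} [] a ρ = iff (λ { (Pρ , ≢) → to (a ρ) Pρ , ≢ }) (λ { (Qρ , ≢) → from (a ρ) Qρ , ≢ })
attach-∖ {L = (R , F) ∷ L} {P = P} {F₀ = F₀} (F₀⊈F ∷ away) (new , a) =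
  (λ {ρ} ρ⊆F → iff (λ { (Pρ , _) → to (new ρ⊆F) Pρ })
                   (λ { R⊈ρ → from (new ρ⊆F) R⊈ρ , (λ { refl → F₀⊈F ρ⊆F }) })) ,
  attach-cong {L = L} (λ ρ → iff (forth ρ) (back ρ)) (attach-∖ {L = L} away a)
  where
  forth : ∀ ρ → ((P ∖ F₀) ⊎⊆ F) ρ → ((P ⊎⊆ F) ∖ F₀) ρ
  forth ρ (inj₁ (Pρ , ≢)) = inj₁ Pρ , ≢
  forth ρ (inj₂ ρ⊆F) = inj₂ ρ⊆F , λ { refl → F₀⊈F ρ⊆F }

  back : ∀ ρ → ((P ⊎⊆ F) ∖ F₀) ρ → ((P ∖ F₀) ⊎⊆ F) ρ
  back ρ (inj₁ Pρ , ≢) = inj₁ (Pρ , ≢)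
  back ρ (inj₂ ρ⊆F , _) = inj₂ ρ⊆F

-- Stellar subdivision of `F`: the new vertex is joined to the boundary of `F`, and `F` itself goes.
stacked : FaceSet n → Subset n → FaceSet (suc n)
stacked K F = split (_⊂ F) (K ∖ F)

module _ {K : FaceSet n} {F σ : Subset n} (closed : DownClosed K) (KF : K F) (maximal : ∀ τ → K τ → ¬ (F ⊂ τ)) where

  stacked-free : Free K σ → Free (stacked K F) (outside ∷ σ)
  stacked-free (Kσ , τ , Kτ , σ⊂τ , only) = (Kσ , λ { refl → maximal τ Kτ σ⊂τ }) , big
    where
    -- `F` properly contains `σ`, so `τ` is `F`; a `g` strictly between `σ` and `F` would be a
    -- second superface.
    new-only : ∀ {g} → g ⊂ F → σ ⊆ g → τ ≡ F × g ≡ σ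
    new-only {g} g⊂F σ⊆g with sym (only F KF (⊆-⊂-trans σ⊆g g⊂F)) | ⊆⇒≡⊎⊂ σ g σ⊆g
    ... | τ≡F | inj₁ σ≡g = τ≡F , sym σ≡g
    ... | refl | inj₂ σ⊂g with refl ← only g (closed (proj₁ g⊂F) KF) σ⊂g = ⊥-elim (⊂⇒⊉ g⊂F (λ z → z))

    big : ∃[ τ′ ] (stacked K F τ′ × outside ∷ σ ⊂ τ′ × (∀ ρ → stacked K F ρ → outside ∷ σ ⊂ ρ → ρ ≡ τ′))
    big with τ ≟ F
    -- The subdivision replaces `F` above `σ` by the cone over `σ`.
    ... | yes refl = inside ∷ σ , σ⊂τ , out⊂in (λ z → z) , λ
      { (inside ∷ g) g⊂F (σ⊆g , _) → cong (inside ∷_) (proj₂ (new-only g⊂F (drop-∷-⊆ σ⊆g)))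
      ; (outside ∷ g) (Kg , g≢F) σ⊂g → contradiction (only g Kg (drop-∷-⊂ σ⊂g)) g≢F }
    ... | no τ≢F = outside ∷ τ , (Kτ , τ≢F) , out⊂ σ⊂τ , λ
      { (inside ∷ g) g⊂F (σ⊆g , _) → contradiction (proj₁ (new-only g⊂F (drop-∷-⊆ σ⊆g))) τ≢F
      ; (outside ∷ g) (Kg , g≢F) σ⊂g → cong (outside ∷_) (only g Kg (drop-∷-⊂ σ⊂g)) }

  stacked-unique : (∀ ρ → Free K ρ → ρ ≡ σ) → ∀ ρ → Free (stacked K F) ρ → ρ ≡ outside ∷ σ
  stacked-unique unique (inside ∷ g) (_ , outside ∷ h , _ , (g⊆h , _) , _) = ⊥-elim (in⊈out g⊆h)
  -- The boundary of a simplex has no free face: for `y` in `F` outside `h`, `g ∪ ⁅ y ⁆` is a second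
  -- superface in it, still missing `x`.
  stacked-unique unique (inside ∷ g) (g⊂F , inside ∷ h , (h⊆F , y , y∈F , y∉h) , g⊂h , only)
    with g⊆h , x , x∈h , x∉g ← drop-∷-⊂ g⊂h =
    contradiction (subst (y ∈_) (∷-injectiveʳ (only (inside ∷ (g ∪ ⁅ y ⁆)) g∪y⊂F (in⊂in g⊂g∪y))) (x∈p∪⁅x⁆ g y)) y∉h
    where
    g∪y⊂F : g ∪ ⁅ y ⁆ ⊂ F
    g∪y⊂F = ∪⁅⁆⊆ (proj₁ g⊂F) y∈F , x , h⊆F x∈h , ∉-∪⁅⁆ x∉g (λ { refl → y∉h x∈h })

    g⊂g∪y : g ⊂ g ∪ ⁅ y ⁆
    g⊂g∪y = p⊆p∪q ⁅ y ⁆ , y , x∈p∪⁅x⁆ g y , y∉h ∘ g⊆h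
  stacked-unique unique (outside ∷ g) ((Kg , g≢F) , τ , Kτ , g⊂τ , only) =
    cong (outside ∷_) (unique g (Kg , big τ Kτ g⊂τ only))
    where
    big : ∀ τ → stacked K F τ → outside ∷ g ⊂ τ → (∀ ρ → stacked K F ρ → outside ∷ g ⊂ ρ → ρ ≡ τ) →
      ∃[ υ ] (K υ × g ⊂ υ × (∀ ρ → K ρ → g ⊂ ρ → ρ ≡ υ))
    big τ Kτ g⊂τ only with g ⊆? F
    -- The cone over `g` is one superface and no other may exist, so in `K` only `F` is left above
    -- `g`.
    ... | yes g⊆F = F , KF , g⊂F , only-F
      where
      g⊂F = ⊆∧≢⇒⊂ g⊆F g≢F

      only-F : ∀ ρ → K ρ → g ⊂ ρ → ρ ≡ F
      only-F ρ Kρ g⊂ρ with ρ ≟ F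
      ... | yes ρ≡F = ρ≡F
      ... | no ρ≢F with () ← trans (only (inside ∷ g) g⊂F (out⊂in (λ z → z)))
                                   (sym (only (outside ∷ ρ) (Kρ , ρ≢F) (out⊂ g⊂ρ)))
    big (inside ∷ h) (h⊆F , _) (g⊆h , _) only | no g⊈F = ⊥-elim (g⊈F (h⊆F ∘ drop-∷-⊆ g⊆h))
    big (outside ∷ h) (Kh , _) g⊂h only | no g⊈F = h , Kh , drop-∷-⊂ g⊂h , λ ρ Kρ g⊂ρ →
      ∷-injectiveʳ (only (outside ∷ ρ) (Kρ , λ { refl → g⊈F (proj₁ g⊂ρ) }) (out⊂ g⊂ρ))

-- The first facet of the shelling is subdivided: the cones over its ridges open the new shelling,
-- and the later cells keep their restrictions.
stack : UniquelyFree (suc d) σ → UniquelyFree (suc d) (outside ∷ σ)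
stack {d} {σ = σ} U = build cells attach proper pure
  where
  open UniquelyFree U

  build : ∀ L → Attach None L K → All Proper L → All (λ c → ∣ proj₂ c ∣ ≡ suc (suc d)) L →
    UniquelyFree (suc d) (outside ∷ σ)
  build [] a _ _ with () ← from (a _) (proj₁ free)
  build ((R , F) ∷ L) (_ , a) (_ ∷ proper) (∣F∣ ∷ pure) = record
    { cells = map cone (∂ F) ++ map (stretch outside) L
    ; K = stacked K F
    ; attach = attach-++ {L = map cone (∂ F)} (attach-cone {L = ∂ F} (attach-∂ F))
        (attach-cong {L = map (stretch outside) L} link (attach-outside {L = L} (attach-∖ {L = L} away a)))
    ; proper = All.++⁺ (All.map⁺ (All.map (λ { (R⊆ , _) → out⊂in R⊆ }) (∂-ridges F)))
        (All.map⁺ (All.map out⊂ proper))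
    ; pure = All.++⁺ (All.map⁺ (All.map (λ { (_ , _ , size) → trans size ∣F∣ }) (∂-ridges F))) (All.map⁺ pure)
    ; covers = covers′
    ; inhabited = suc (proj₁ inhabited) , there (proj₂ inhabited)
    ; free = stacked-free closed KF maximal free
    ; unique = stacked-unique closed KF maximal unique
    }
    where
    KF : K F
    KF = from (attach-any {L = L} a F) (inj₁ (inj₂ (λ z → z)))

    maximal : ∀ τ → K τ → ¬ (F ⊂ τ)
    maximal τ Kτ F⊂τ = <⇒≱ (p⊂q⇒∣p∣<∣q∣ F⊂τ) (≤-trans (size≤ Kτ) (≤-reflexive (sym ∣F∣)))

    -- Later facets are new and have the size of `F`, so none contains `F`.
    away : All (λ c → ¬ (F ⊆ proj₂ c)) L
    away = All.zipWith
      (λ { (∣G∣ , fresh) F⊆G → fresh (inj₂ (⊆-reflexive (sym (⊆∧≥⇒≡ F⊆G (≤-reflexive (trans ∣G∣ (sym ∣F∣))))))) })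
      (pure , attach-fresh {L = L} a proper)

    link : ∀ ρ → (_⊂ F) (tail ρ) ⇔ split (_⊂ F) ((None ⊎⊆ F) ∖ F) ρ
    link (inside ∷ p) = iff id id
    link (outside ∷ p) = iff (λ { p⊂F@(s , _) → inj₂ s , λ { refl → ⊂⇒⊉ p⊂F (λ z → z) } })
      (λ { (inj₂ s , p≢F) → ⊆∧≢⇒⊂ s p≢F })

    covers′ : ∀ v → stacked K F ⁅ v ⁆
    covers′ zero with x , x∈F ← ∣∣>0⇒Nonempty F (subst (0 <_) (sym ∣F∣) (s≤s z≤n)) = ⊥⊆ , x , x∈F , ∉⊥
    -- A vertex is not the removed facet: in dimension `suc d`, `F` has at least two elements.
    covers′ (suc v) = covers v , λ { refl → contradiction (trans (sym (∣⁅x⁆∣≡1 v)) ∣F∣) (λ ()) }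

-- The two-dimensional base complex, checked by enumeration.

triple : Fin 7 → Fin 7 → Fin 7 → Subset 7
triple a b c = ⁅ a ⁆ ∪ ⁅ b ⁆ ∪ ⁅ c ⁆

-- Found by a randomised computer search over shellings in which no triangle
-- is attached along its whole boundary.
dunceCells : List (Cell 7)
dunceCells =
  (∅                     , triple (# 0) (# 1) (# 2)) ∷
  (⁅ # 6 ⁆               , triple (# 0) (# 2) (# 6)) ∷
  (⁅ # 1 ⁆ ∪ ⁅ # 6 ⁆     , triple (# 0) (# 1) (# 6)) ∷
  (⁅ # 3 ⁆               , triple (# 1) (# 2) (# 3)) ∷
  (⁅ # 3 ⁆ ∪ ⁅ # 6 ⁆     , triple (# 2) (# 3) (# 6)) ∷
  (⁅ # 5 ⁆               , triple (# 1) (# 3) (# 5)) ∷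
  (⁅ # 5 ⁆ ∪ ⁅ # 6 ⁆     , triple (# 3) (# 5) (# 6)) ∷
  (⁅ # 0 ⁆ ∪ ⁅ # 5 ⁆     , triple (# 0) (# 5) (# 6)) ∷
  (⁅ # 4 ⁆               , triple (# 1) (# 4) (# 6)) ∷
  (⁅ # 4 ⁆ ∪ ⁅ # 5 ⁆     , triple (# 1) (# 4) (# 5)) ∷
  (⁅ # 0 ⁆ ∪ ⁅ # 4 ⁆     , triple (# 0) (# 4) (# 5)) ∷
  (⁅ # 3 ⁆ ∪ ⁅ # 4 ⁆     , triple (# 3) (# 4) (# 6)) ∷
  (⁅ # 0 ⁆ ∪ ⁅ # 3 ⁆     , triple (# 0) (# 3) (# 4)) ∷ []

Generated : List (Cell n) → FaceSet n
Generated L ρ = Any (λ c → ρ ⊆ proj₂ c) L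

generated? : (L : List (Cell n)) → Decidable (Generated L)
generated? L ρ = Any.any? (λ c → ρ ⊆? proj₂ c) L

allSubsets? : {P : FaceSet n} → Decidable P → Dec (∀ p → P p)
allSubsets? {zero} P? = map′ (λ { P[] [] → P[] }) (λ P∀ → P∀ []) (P? [])
allSubsets? {suc n} P? = map′
  (λ { (Pi , Po) (inside ∷ p) → Pi p ; (Pi , Po) (outside ∷ p) → Po p })
  (λ P∀ → (λ p → P∀ (inside ∷ p)) , (λ p → P∀ (outside ∷ p)))
  (allSubsets? (λ p → P? (inside ∷ p)) ×-dec allSubsets? (λ p → P? (outside ∷ p)))

_⇔-dec_ : {A B : Set} → Dec A → Dec B → Dec (A ⇔ B)
a? ⇔-dec b? = map′ (λ { (f , g) → iff f g }) (λ e → to e , from e) ((a? →-dec b?) ×-dec (b? →-dec a?))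

attach? : {P Q : FaceSet n} → Decidable P → (L : List (Cell n)) → Decidable Q → Dec (Attach P L Q)
attach? P? [] Q? = allSubsets? (λ ρ → P? ρ ⇔-dec Q? ρ)
attach? P? ((R , F) ∷ L) Q? =
  map′ (λ new {ρ} → new ρ) (λ new ρ → new {ρ})
    (allSubsets? (λ ρ → (ρ ⊆? F) →-dec (P? ρ ⇔-dec ¬? (R ⊆? ρ))))
  ×-dec attach? (λ ρ → P? ρ ⊎-dec (ρ ⊆? F)) L Q?

-- A certificate against freeness that only inspects the list of facets.
Crossing : List (Cell n) → FaceSet n
Crossing L ρ = Any (λ c → ρ ⊂ proj₂ c × Any (λ c′ → ρ ⊂ proj₂ c′ × proj₂ c′ ≢ proj₂ c) L) L

crossing? : (L : List (Cell n)) → Decidable (Crossing L)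
crossing? L ρ = Any.any? (λ c → (ρ ⊂? proj₂ c) ×-dec
  Any.any? (λ c′ → (ρ ⊂? proj₂ c′) ×-dec ¬? (proj₂ c′ ≟ proj₂ c)) L) L

crossing⇒¬free : Crossing L ρ → ¬ Free (Generated L) ρ
crossing⇒¬free {L = L} cross (_ , _ , _ , _ , only)
  with (_ , F) , F∈ , ρ⊂F , cross′ ← find cross
  with (_ , F′) , F′∈ , ρ⊂F′ , F′≢F ← find cross′ =
  F′≢F (trans (only F′ (Any.map (λ { refl {_} → id }) F′∈) ρ⊂F′) (sym (only F (Any.map (λ { refl {_} → id }) F∈) ρ⊂F)))

-- The free edge lies only in the last triangle of the shelling. It contains the vertex 0, as
-- `suspend` requires.
leaf triangle : Subset 7
leaf = ⁅ # 0 ⁆ ∪ ⁅ # 3 ⁆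
triangle = triple (# 0) (# 3) (# 4)

dunce-face? : Decidable (Generated dunceCells)
dunce-face? = generated? dunceCells

dunce-attach : Attach None dunceCells (Generated dunceCells)
dunce-attach = toWitness {a? = attach? (λ _ → no (λ ())) dunceCells dunce-face?} _

dunce-proper : All Proper dunceCells
dunce-proper = toWitness {a? = All.all? (λ c → proj₁ c ⊂? proj₂ c) dunceCells} _

dunce-free : Free (Generated dunceCells) leaf
dunce-free = toWitness {a? = dunce-face? leaf} _ , triangle ,
  toWitness {a? = dunce-face? triangle} _ , toWitness {a? = leaf ⊂? triangle} _ ,
  toWitness {a? = allSubsets? (λ ρ → dunce-face? ρ →-dec ((leaf ⊂? ρ) →-dec (ρ ≟ triangle)))} _

-- Leaves two kinds of faces to exclude: triangles, too large to have a proper superface, and faces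
-- of two triangles, handled by `crossing⇒¬free`.
dunce-unfree : ∀ ρ → Generated dunceCells ρ → ρ ≡ leaf ⊎ ∣ ρ ∣ ≡ 3 ⊎ Crossing dunceCells ρ
dunce-unfree = toWitness {a? = allSubsets? (λ ρ → dunce-face? ρ →-dec
  ((ρ ≟ leaf) ⊎-dec ((∣ ρ ∣ ℕ.≟ 3) ⊎-dec crossing? dunceCells ρ)))} _

dunce-size : ∀ ρ → Generated dunceCells ρ → ∣ ρ ∣ ≤ 3
dunce-size = toWitness {a? = allSubsets? (λ ρ → dunce-face? ρ →-dec (∣ ρ ∣ ℕ.≤? 3))} _

dunce : UniquelyFree 2 leaf
dunce = record
  { cells = dunceCells
  ; K = Generated dunceCells
  ; attach = dunce-attach
  ; proper = dunce-proper
  ; pure = toWitness {a? = All.all? (λ c → ∣ proj₂ c ∣ ℕ.≟ 3) dunceCells} _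
  ; covers = toWitness {a? = all? (λ v → dunce-face? ⁅ v ⁆)} _
  ; inhabited = zero , here
  ; free = dunce-free
  ; unique = unique
  }
  where
  unique : ∀ ρ → Free (Generated dunceCells) ρ → ρ ≡ leaf
  unique ρ ρ-free@(Kρ , τ , Kτ , ρ⊂τ , _) =
    [ id
    , [ (λ ∣ρ∣ → contradiction (subst (_< ∣ τ ∣) ∣ρ∣ (p⊂q⇒∣p∣<∣q∣ ρ⊂τ)) (≤⇒≯ (dunce-size τ Kτ)))
      , (λ cross → contradiction ρ-free (crossing⇒¬free {L = dunceCells} cross)) ]′ ]′ (dunce-unfree ρ Kρ)

-- Assembly and vertex count.

suspended : ∀ k → ∃[ s ] UniquelyFree (2 + k) {7 + k} (inside ∷ s)
suspended zero = _ , dunce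
suspended (suc k) = _ , suspend (proj₂ (suspended k))

stacks : ∀ m {d n} {σ : Subset n} → UniquelyFree (suc d) σ → ∃[ τ ] UniquelyFree (suc d) {m + n} τ
stacks zero U = _ , U
stacks (suc m) U = _ , stack (proj₂ (stacks m U))

-- In dimension d = `2 + k` the suspensions give d + 5 vertices, so 2^d - 4 subdivisions reach the
-- target. Truncated subtraction is exact here because 4 ≤ 2^d.
vertex-count : ∀ k → (2 ^ (2 + k) ∸ 4) + (7 + k) ≡ 2 ^ (2 + k) + (2 + k) + 1
vertex-count k = begin
  (2 ^ (2 + k) ∸ 4) + (7 + k)       ≡⟨ cong (2 ^ (2 + k) ∸ 4 +_) (+-comm 1 (4 + (2 + k))) ⟩
  (2 ^ (2 + k) ∸ 4) + (4 + (2 + k) + 1)   ≡⟨ +-assoc (2 ^ (2 + k) ∸ 4) (4 + (2 + k)) 1 ⟨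
  (2 ^ (2 + k) ∸ 4) + (4 + (2 + k)) + 1   ≡⟨ cong (_+ 1) (+-assoc (2 ^ (2 + k) ∸ 4) 4 (2 + k)) ⟨
  (2 ^ (2 + k) ∸ 4) + 4 + (2 + k) + 1     ≡⟨ cong (λ m → m + (2 + k) + 1) (m∸n+n≡m (^-monoʳ-≤ 2 (m≤m+n 2 k))) ⟩
  2 ^ (2 + k) + (2 + k) + 1           ∎
  where open ≡-Reasoning

theorem2p3 : ∀ (d : ℕ) → 2 ≤ d →
    Σ[ Σd ∈ Complex (2 ^ d + d + 1) ]
    ( HasDimension (Face Σd) d
    × Collapsible (Face Σd)
    × Shellable (Face Σd) d
    × ExactlyOneFreeFace (Face Σd) )
theorem2p3 (suc (suc k)) (s≤s (s≤s _)) =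
  subst (λ n → Σ[ Σd ∈ Complex n ]
    ( HasDimension (Face Σd) (2 + k)
    × Collapsible (Face Σd)
    × Shellable (Face Σd) (2 + k)
    × ExactlyOneFreeFace (Face Σd) )) (vertex-count k)
    (complex , hasDimension , collapsible , shellable (s≤s z≤n) , exactlyOneFreeFace)
  where open UniquelyFree (proj₂ (stacks (2 ^ (2 + k) ∸ 4) (proj₂ (suspended k))))
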